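{- For every positive integer $t$ and every finite graph $G$ of degeneracy at most $t$, the hypergraph of closed neighborhoods in $G$ has a sample compression scheme of size $t+\lceil\log_2(t+1)\rceil+1$.
   Context: $G$ has degeneracy at most $t$ if there is a total order $\prec$ on $V(G)$ such that every vertex $v$ has at most $t$ neighbors $u$ with $u\prec v$. The hypergraph of closed neighborhoods in $G$ has vertex set $V(G)$ and hyperedges $B_G(c,1)=\{c\}\cup N_G(c)$ for $c\in V(G)$. For a hypergraph $H$ (finite $V(H)$, $E(H)\subseteq 2^{V(H)}$): a sample is a pair $(X^+,X^-)$ of subsets of $V(H)$ such that some hyperedge $e$ has $X^+\subseteq e$, $X^-\cap e=\emptyset$; $\mathcal{S}(H)$ is the set of samples; $S$ realizes $(X^+,X^-)$ if $X^+\subseteq S$, $S\cap X^-=\emptyset$; a subsample is a sample $(Y^+,Y^-)$ with $Y^\pm\subseteq X^\pm$, of size $|Y^+\cup Y^-|$. A sample compression scheme is $(\kappa,\rho)$ with $\kappa:\mathcal{S}(H)\to\mathcal{S}(H)\times\{0,1\}^*$ and $\rho:\mathcal{S}(H)\times\{0,1\}^*\to 2^{V(H)}$ such that for every sample the first component of $\kappa(X^+,X^-)$ is a subsample of it and $\rho(\kappa(X^+,X^-))$ realizes it; its size is $k_1+k_2$, $k_1$ the maximum subsample size and $k_2$ the maximum bitstring length output by $\kappa$. -}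

module Defs where

open import Data.Bool using (Bool)
open import Data.Fin using (Fin)
open import Data.Fin.Properties using (any?)
open import Data.Fin.Subset
  using (Subset; inside; outside; _⊆_; _∩_; _∪_; ⁅_⁆; ∣_∣; Empty)
open import Data.Fin.Subset.Properties using (_⊆?_; nonempty?; anySubset?)
open import Data.List using (List; length)
open import Data.Nat using (ℕ; zero; suc; _+_; _≤_; _⊔_)
open import Data.Product using (∃; Σ-syntax; ∃-syntax; _×_; _,_; proj₁; proj₂)
open import Data.Vec using ([]; _∷_; tabulate)
open import Data.Vec.Properties using (≡-dec)
import Data.Bool.Properties as Bool
open import Level using (0ℓ)
open import Relation.Binary using (Rel; Decidable; Symmetric; IsStrictTotalOrder)
open import Relation.Binary.PropositionalEquality using (_≡_)
open import Relation.Nullary using (Dec; yes; no; ¬_; does; ¬?; _×-dec_)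
open import Relation.Unary using (Pred) renaming (Decidable to Decidable₁)

-- Finite simple graphs with vertex set Fin n.
record Graph (n : ℕ) : Set₁ where
  field
    Adj    : Rel (Fin n) 0ℓ
    Adj?   : Decidable Adj
    sym    : Symmetric Adj
    irrefl : ∀ v → ¬ Adj v v

fromDec : ∀ {n} {P : Pred (Fin n) 0ℓ} → Decidable₁ P → Subset n
fromDec P? = tabulate (λ v → does (P? v))

module _ {n : ℕ} (G : Graph n) where
  open Graph G

  N : Fin n → Subset n
  N c = fromDec (Adj? c)

  B₁ : Fin n → Subset n
  B₁ c = ⁅ c ⁆ ∪ N c

  module _ {_≺_ : Rel (Fin n) 0ℓ} (sto : IsStrictTotalOrder _≡_ _≺_) where
    open IsStrictTotalOrder sto using (_<?_)

    earlierNeighbours : Fin n → Subset n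
    earlierNeighbours v = fromDec (λ u → Adj? v u ×-dec (u <? v))

  DegeneracyAtMost : ℕ → Set₁
  DegeneracyAtMost t =
    ∃ λ (_≺_ : Rel (Fin n) 0ℓ) → Σ[ sto ∈ IsStrictTotalOrder _≡_ _≺_ ]
      (∀ v → ∣ earlierNeighbours sto v ∣ ≤ t)

-- Hypergraphs with vertex set Fin n. The hyperedges form a set of subsets
-- (without multiplicity), so they are given by a decidable predicate.
record Hypergraph (n : ℕ) : Set₁ where
  field
    E  : Pred (Subset n) 0ℓ
    E? : Decidable₁ E

closedNeighbourhoods : ∀ {n} → Graph n → Hypergraph n
closedNeighbourhoods G = record
  { E  = λ e → ∃[ c ] e ≡ B₁ G c
  ; E? = λ e → any? (λ c → ≡-dec Bool._≟_ e (B₁ G c))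
  }

Realizes : ∀ {n} → Subset n → Subset n → Subset n → Set
Realizes S X⁺ X⁻ = X⁺ ⊆ S × Empty (S ∩ X⁻)

module _ {n : ℕ} (H : Hypergraph n) where
  open Hypergraph H

  IsSample : Subset n → Subset n → Set
  IsSample X⁺ X⁻ = ∃[ e ] E e × X⁺ ⊆ e × Empty (X⁻ ∩ e)

  isSample? : ∀ X⁺ X⁻ → Dec (IsSample X⁺ X⁻)
  isSample? X⁺ X⁻ = anySubset? λ e →
    E? e ×-dec (X⁺ ⊆? e) ×-dec ¬? (nonempty? (X⁻ ∩ e))

  -- The proof is irrelevant, so that a sample is just the pair (X⁺ , X⁻):
  -- functions on samples cannot inspect the witnessing hyperedge.
  record Sample : Set where
    constructor mkSample
    field
      pos       : Subset n
      neg       : Subset n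
      .isSample : IsSample pos neg

open Sample public using (pos; neg)

-- The maximum of f over all subsets of Fin n.
maxSubset : ∀ {n} → (Subset n → ℕ) → ℕ
maxSubset {zero}  f = f []
maxSubset {suc n} f =
  maxSubset (λ p → f (inside ∷ p)) ⊔ maxSubset (λ p → f (outside ∷ p))

valueAt : ∀ {n} {H : Hypergraph n} → (Sample H → ℕ) →
          ∀ X⁺ X⁻ → Dec (IsSample H X⁺ X⁻) → ℕ
valueAt f X⁺ X⁻ (yes s) = f (mkSample X⁺ X⁻ s)
valueAt f X⁺ X⁻ (no _)  = 0

-- The maximum of f over all samples of H, which is 0 if there are none.
maxSample : ∀ {n} (H : Hypergraph n) → (Sample H → ℕ) → ℕ
maxSample H f = maxSubset λ X⁺ → maxSubset λ X⁻ → valueAt f X⁺ X⁻ (isSample? H X⁺ X⁻)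

module _ {n : ℕ} {H : Hypergraph n} where

  _⊑_ : Sample H → Sample H → Set
  Y ⊑ X = pos Y ⊆ pos X × neg Y ⊆ neg X

  sampleSize : Sample H → ℕ
  sampleSize Y = ∣ pos Y ∪ neg Y ∣

record CompressionScheme {n : ℕ} (H : Hypergraph n) : Set where
  field
    κ          : Sample H → Sample H × List Bool
    ρ          : Sample H × List Bool → Subset n
    κ-sub      : ∀ X → proj₁ (κ X) ⊑ X
    ρκ-realize : ∀ X → Realizes (ρ (κ X)) (pos X) (neg X)

  k₁ : ℕ
  k₁ = maxSample H (λ X → sampleSize (proj₁ (κ X)))

  k₂ : ℕ
  k₂ = maxSample H (λ X → length (proj₂ (κ X)))

  size : ℕ
  size = k₁ + k₂

{-# OPTIONS --safe #-}
-- Let c be the centre of a hyperedge witnessing the sample (X⁺, X⁻). Every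
-- vertex of X⁺ is c, an earlier neighbour of c, or a later neighbour of c.
-- If only earlier neighbours occur, then ∣X⁺∣ ≤ t, and X⁺ itself is stored and
-- decompressed to X⁺. Otherwise some x ∈ X⁺ is c or has c among its at most t
-- earlier neighbours; storing x and ⌈log₂ (t + 1)⌉ bits then identifies c. One
-- more bit tells the two cases apart.
module Submission where

open import Defs
open import Data.Bool using (Bool; true; false)
open import Data.Fin using (Fin; zero; suc; toℕ; fromℕ<)
open import Data.Fin.Properties using (any?; toℕ<n; toℕ-fromℕ<)
open import Data.Fin.Subset
  using (Subset; inside; outside; _∈_; _⊆_; _∩_; _∪_; ⊥; ⁅_⁆; ∣_∣; Empty)
open import Data.Fin.Subset.Properties
  using (_∈?_; _⊆?_; nonempty?; ∉⊥; ⊥⊆; x∈⁅x⁆; x∈⁅y⁆⇒x≡y; ∣⁅x⁆∣≡1;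
         ∪-identityʳ; ∩-comm; p⊆q⇒∣p∣≤∣q∣; x∈p∪q⁻; x∈p∩q⁺; x∈p∩q⁻)
open import Data.List using (List; []; _∷_; length)
open import Data.Maybe using (Maybe; just; nothing; fromMaybe)
import Data.Maybe as Maybe
open import Data.Maybe.Properties using (map-just)
open import Data.Nat
  using (ℕ; zero; suc; _+_; _*_; _∸_; _^_; _≤_; _<_; _<?_; z≤n; s≤s; ⌊_/2⌋; ⌈_/2⌉)
open import Data.Nat.Induction using (<-wellFounded)
open import Data.Nat.Logarithm using (⌈log₂_⌉)
open import Data.Nat.Logarithm.Core using (⌈log2⌉)
open import Data.Nat.Properties
open import Data.Product using (Σ-syntax; ∃-syntax; _×_; _,_; proj₁; proj₂)
open import Data.Sum using (inj₁; inj₂)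
open import Data.Vec using ([]; _∷_; here; there)
open import Data.Vec.Properties using ([]=⇒lookup; lookup⇒[]=; lookup∘tabulate)
open import Function using (_∘_)
open import Induction.WellFounded using (Acc; acc)
open import Level using (0ℓ)
open import Relation.Binary using (Rel; IsStrictTotalOrder; tri<; tri≈; tri>)
open import Relation.Binary.PropositionalEquality
open import Relation.Nullary using (Dec; yes; no; ¬_; ¬?; _×-dec_; contradiction)
open import Relation.Nullary.Decidable using (dec-true; recompute)
open import Relation.Unary using (Pred) renaming (Decidable to Decidable₁)

-- Induction along the recursion of `⌈log2⌉`, which adds one and passes to `h`, half of `n + 2`
-- rounded up. The accessibility proof is arbitrary so that the induction hypothesis applies to the
-- one produced by the recursion.
n≤2^⌈log2⌉n : ∀ n (rs : Acc _<_ n) → n ≤ 2 ^ ⌈log2⌉ n rs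
n≤2^⌈log2⌉n 0 _ = z≤n
n≤2^⌈log2⌉n 1 _ = ≤-refl
n≤2^⌈log2⌉n (suc (suc n)) (acc rs) = begin
  suc (suc n)                    ≡⟨ cong (2 +_) (⌊n/2⌋+⌈n/2⌉≡n n) ⟨
  suc (suc (⌊ n /2⌋ + ⌈ n /2⌉))  ≤⟨ s≤s (s≤s (+-monoˡ-≤ ⌈ n /2⌉ (⌊n/2⌋≤⌈n/2⌉ n))) ⟩
  suc (suc (⌈ n /2⌉ + ⌈ n /2⌉))  ≡⟨ cong suc (+-suc ⌈ n /2⌉ ⌈ n /2⌉) ⟨
  h + h                          ≡⟨ cong (h +_) (+-identityʳ h) ⟨
  2 * h                          ≤⟨ *-monoʳ-≤ 2 (n≤2^⌈log2⌉n h _) ⟩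
  2 * 2 ^ ⌈log2⌉ h _             ∎
  where
  open ≤-Reasoning
  h = suc ⌈ n /2⌉

n≤2^⌈log₂n⌉ : ∀ n → n ≤ 2 ^ ⌈log₂ n ⌉
n≤2^⌈log₂n⌉ n = n≤2^⌈log2⌉n n (<-wellFounded n)

fromBits : List Bool → ℕ
fromBits []           = 0
fromBits (false ∷ bs) = fromBits bs
fromBits (true  ∷ bs) = 2 ^ length bs + fromBits bs

-- The most significant bit records whether `2 ^ m ≤ i`, and the remainder goes into the other bits.
-- Leading zeros are kept, so the length is exactly `m`.
toBits : ∀ m i → i < 2 ^ m → ∃[ bs ] length bs ≡ m × fromBits bs ≡ i
toBits zero    zero    _        = [] , refl , refl
toBits zero    (suc i) (s≤s ())
toBits (suc m) i       i<2^1+m with i <? 2 ^ m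
... | yes i<2^m with bs , len , val ← toBits m i i<2^m =
  false ∷ bs , cong suc len , val
... | no i≮2^m =
  let 2^m≤i          = ≮⇒≥ i≮2^m
      i∸2^m<2^m      = +-cancelˡ-< (2 ^ m) _ _
        (subst₂ _<_ (sym (m+[n∸m]≡n 2^m≤i)) (cong (2 ^ m +_) (+-identityʳ (2 ^ m))) i<2^1+m)
      bs , len , val = toBits m (i ∸ 2 ^ m) i∸2^m<2^m
  in true ∷ bs , cong suc len ,
     trans (cong₂ (λ k j → 2 ^ k + j) len val) (m+[n∸m]≡n 2^m≤i)

-- Elements are counted in the order of `Fin n`, which is unrelated to the degeneracy order.
nth : ∀ {n} → Subset n → ℕ → Maybe (Fin n)
nth []            _       = nothing
nth (inside  ∷ p) zero    = just zero
nth (inside  ∷ p) (suc i) = Maybe.map suc (nth p i)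
nth (outside ∷ p) i       = Maybe.map suc (nth p i)

nth-surjective : ∀ {n} {p : Subset n} {v} → v ∈ p → ∃[ i ] i < ∣ p ∣ × nth p i ≡ just v
nth-surjective {p = inside ∷ p}  here        = 0 , s≤s z≤n , refl
nth-surjective {p = inside ∷ p}  (there v∈p) with i , i<∣p∣ , eq ← nth-surjective v∈p =
  suc i , s≤s i<∣p∣ , map-just eq
nth-surjective {p = outside ∷ p} (there v∈p) with i , i<∣p∣ , eq ← nth-surjective v∈p =
  i , i<∣p∣ , map-just eq

module _ {n} {P : Pred (Fin n) 0ℓ} (P? : Decidable₁ P) where

  ∈-fromDec⁺ : ∀ {v} → P v → v ∈ fromDec P?
  ∈-fromDec⁺ {v} Pv = lookup⇒[]= v _ (trans (lookup∘tabulate _ v) (dec-true (P? v) Pv))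

  ∈-fromDec⁻ : ∀ {v} → v ∈ fromDec P? → P v
  ∈-fromDec⁻ {v} v∈ with P? v | trans (sym (lookup∘tabulate _ v)) ([]=⇒lookup v∈)
  ... | yes Pv | _ = Pv
  ... | no _   | ()

maxSubset-lub : ∀ {n} (f : Subset n → ℕ) {k} → (∀ p → f p ≤ k) → maxSubset f ≤ k
maxSubset-lub {zero}  f f≤k = f≤k _
maxSubset-lub {suc n} f f≤k =
  ⊔-lub (maxSubset-lub (f ∘ (inside ∷_)) (f≤k ∘ (inside ∷_)))
        (maxSubset-lub (f ∘ (outside ∷_)) (f≤k ∘ (outside ∷_)))

maxSample-lub : ∀ {n} (H : Hypergraph n) (f : Sample H → ℕ) {k} →
                (∀ X → f X ≤ k) → maxSample H f ≤ k
maxSample-lub H f {k} f≤k =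
  maxSubset-lub _ λ X⁺ → maxSubset-lub _ λ X⁻ → valueAt≤k X⁺ X⁻ (isSample? H X⁺ X⁻)
  where
  valueAt≤k : ∀ X⁺ X⁻ (d : Dec (IsSample H X⁺ X⁻)) → valueAt f X⁺ X⁻ d ≤ k
  valueAt≤k X⁺ X⁻ (yes s) = f≤k (mkSample X⁺ X⁻ s)
  valueAt≤k X⁺ X⁻ (no _)  = z≤n

realizes? : ∀ {n} (S X⁺ X⁻ : Subset n) → Dec (Realizes S X⁺ X⁻)
realizes? S X⁺ X⁻ = (X⁺ ⊆? S) ×-dec ¬? (nonempty? (S ∩ X⁻))

module _ {n} {H : Hypergraph n} where

  -- The same hyperedge is a witness. Storing no negative vertices keeps the size of the subsample
  -- down to that of its positive part.
  IsSample-pos : ∀ {X⁺ X⁻ Y⁺} → Y⁺ ⊆ X⁺ → IsSample H X⁺ X⁻ → IsSample H Y⁺ ⊥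
  IsSample-pos Y⁺⊆X⁺ (e , e∈E , X⁺⊆e , _) =
    e , e∈E , X⁺⊆e ∘ Y⁺⊆X⁺ ,
    λ (_ , v∈) → ∉⊥ (proj₁ (x∈p∩q⁻ ⊥ e v∈))

  posSubsample : ∀ (X : Sample H) {Y⁺} → Y⁺ ⊆ pos X → Sample H
  posSubsample (mkSample X⁺ X⁻ s) {Y⁺} Y⁺⊆X⁺ = mkSample Y⁺ ⊥ (IsSample-pos Y⁺⊆X⁺ s)

module _ {n} (G : Graph n) {_≺_ : Rel (Fin n) 0ℓ} (sto : IsStrictTotalOrder _≡_ _≺_) where
  open Graph G renaming (sym to Adj-sym)
  open IsStrictTotalOrder sto using (compare) renaming (_<?_ to _≺?_)

  private
    H = closedNeighbourhoods G
    earlier = earlierNeighbours G sto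

  -- Indices beyond the number of earlier neighbours give the junk value x.
  candidate : Fin n → ℕ → Fin n
  candidate x zero    = x
  candidate x (suc i) = fromMaybe x (nth (earlier x) i)

  -- Index 0 is reserved for `x`, so positions shift by one and the bound on `i` is not strict. With
  -- at most `t` earlier neighbours, `t + 1` indices suffice.
  earlier-candidate : ∀ {c x} → c ∈ earlier x → ∃[ i ] i ≤ ∣ earlier x ∣ × candidate x i ≡ c
  earlier-candidate {x = x} c∈ with i , i< , eq ← nth-surjective c∈ =
    suc i , i< , cong (fromMaybe x) eq

  -- In the `true` case the positive part is meant to be a singleton.
  decompress : Sample H × List Bool → Subset n
  decompress (Y , true ∷ bs) with nonempty? (pos Y)
  ... | yes (x , _) = B₁ G (candidate x (fromBits bs))
  ... | no _        = ⊥
  -- This covers the flag `false` and, as a default, the empty bit string.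
  decompress (Y , _) = pos Y

  -- The vertex returned by `nonempty?` is not specified, but a singleton leaves only one choice.
  decompress-singleton : ∀ Y bs {x} → pos Y ≡ ⁅ x ⁆ →
    decompress (Y , true ∷ bs) ≡ B₁ G (candidate x (fromBits bs))
  decompress-singleton (mkSample _ _ _) bs {x} refl with nonempty? ⁅ x ⁆
  ... | yes (y , y∈⁅x⁆) = cong (λ z → B₁ G (candidate z (fromBits bs))) (x∈⁅y⁆⇒x≡y x y∈⁅x⁆)
  ... | no  ⁅x⁆≡∅       = contradiction (x , x∈⁅x⁆ x) ⁅x⁆≡∅

  module _ {t} (1≤t : 1 ≤ t) (degenerate : ∀ v → ∣ earlier v ∣ ≤ t) where

    -- The centre of the witnessing hyperedge is not mentioned, because a compressor cannot inspect
    -- it. Any candidate whose closed neighbourhood realizes the sample will do, and such a pair can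
    -- be found by finite search.
    Identifies : Subset n → Subset n → Fin n → Fin (suc t) → Set
    Identifies X⁺ X⁻ x i = x ∈ X⁺ × Realizes (B₁ G (candidate x (toℕ i))) X⁺ X⁻

    identified? : ∀ X⁺ X⁻ → Dec (∃[ x ] ∃[ i ] Identifies X⁺ X⁻ x i)
    identified? X⁺ X⁻ = any? λ x → any? λ i → (x ∈? X⁺) ×-dec realizes? _ X⁺ X⁻

    identifies : ∀ {X⁺ X⁻ x c} j → j ≤ t → candidate x j ≡ c →
                 x ∈ X⁺ → Realizes (B₁ G c) X⁺ X⁻ → ∃[ i ] Identifies X⁺ X⁻ x i
    identifies {X⁺} {X⁻} {x} j j≤t eq x∈X⁺ r =
      fromℕ< (s≤s j≤t) , x∈X⁺ ,
      subst (λ c → Realizes (B₁ G c) X⁺ X⁻)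
        (sym (trans (cong (candidate x) (toℕ-fromℕ< (s≤s j≤t))) eq)) r

    -- If some `x` in `X⁺` were `c` or a later neighbour of `c`, an index at `x` would yield `c`,
    -- whose closed neighbourhood realizes the sample. Hence `X⁺` consists of earlier neighbours of
    -- `c`.
    unidentified-small : ∀ {X⁺ X⁻} → IsSample H X⁺ X⁻ →
                         ¬ (∃[ x ] ∃[ i ] Identifies X⁺ X⁻ x i) → ∣ X⁺ ∣ ≤ t
    unidentified-small {X⁺} {X⁻} (_ , (c , refl) , X⁺⊆B , X⁻∩B≡∅) unidentified =
      ≤-trans (p⊆q⇒∣p∣≤∣q∣ X⁺⊆earlier) (degenerate c)
      where
      r : Realizes (B₁ G c) X⁺ X⁻
      r = X⁺⊆B , subst Empty (∩-comm X⁻ (B₁ G c)) X⁻∩B≡∅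

      X⁺⊆earlier : X⁺ ⊆ earlier c
      X⁺⊆earlier {x} x∈X⁺ with x∈p∪q⁻ ⁅ c ⁆ (N G c) (X⁺⊆B x∈X⁺)
      ... | inj₁ x∈⁅c⁆ =
        contradiction (x , identifies 0 z≤n (x∈⁅y⁆⇒x≡y c x∈⁅c⁆) x∈X⁺ r) unidentified
      ... | inj₂ x∈N with ∈-fromDec⁻ (Adj? c) x∈N | compare x c
      ...   | adj | tri< x≺c _ _  = ∈-fromDec⁺ (λ u → Adj? c u ×-dec (u ≺? c)) (adj , x≺c)
      ...   | adj | tri≈ _ refl _ = contradiction adj (irrefl c)
      ...   | adj | tri> _ _ c≺x
        with i , i≤ , eq ← earlier-candidate
               (∈-fromDec⁺ (λ u → Adj? x u ×-dec (u ≺? x)) (Adj-sym adj , c≺x)) =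
        contradiction (x , identifies i (≤-trans i≤ (degenerate x)) eq x∈X⁺ r) unidentified

    -- The size of a scheme adds two separate maxima, so each output has to meet both bounds,
    -- whichever case produced it.
    Compressed : Sample H → Set
    Compressed X = Σ[ Z ∈ Sample H × List Bool ]
      proj₁ Z ⊑ X × Realizes (decompress Z) (pos X) (neg X) ×
      sampleSize (proj₁ Z) ≤ t × length (proj₂ Z) ≤ ⌈log₂ (t + 1) ⌉ + 1

    t<2^ : t < 2 ^ ⌈log₂ (t + 1) ⌉
    t<2^ = subst (_≤ 2 ^ ⌈log₂ (t + 1) ⌉) (+-comm t 1) (n≤2^⌈log₂n⌉ (t + 1))

    compress : ∀ X → Compressed X
    compress X@(mkSample X⁺ X⁻ s) with identified? X⁺ X⁻
    ... | yes (x , i , x∈X⁺ , r)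
      with bs , len , val ← toBits ⌈log₂ (t + 1) ⌉ (toℕ i) (≤-trans (toℕ<n i) t<2^) =
      (Y , true ∷ bs) , (⁅x⁆⊆X⁺ , ⊥⊆) ,
      subst (λ S → Realizes S X⁺ X⁻)
        (sym (trans (decompress-singleton Y bs refl) (cong (B₁ G ∘ candidate x) val))) r ,
      -- One stored vertex fits the bound `t` because `t` is positive.
      ≤-trans (≤-reflexive (trans (cong ∣_∣ (∪-identityʳ ⁅ x ⁆)) (∣⁅x⁆∣≡1 x))) 1≤t ,
      ≤-reflexive (trans (cong suc len) (+-comm 1 _))
      where
      ⁅x⁆⊆X⁺ : ⁅ x ⁆ ⊆ X⁺
      ⁅x⁆⊆X⁺ v∈⁅x⁆ = subst (_∈ X⁺) (sym (x∈⁅y⁆⇒x≡y x v∈⁅x⁆)) x∈X⁺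

      Y = posSubsample X ⁅x⁆⊆X⁺
    ... | no unidentified =
      (posSubsample X (λ v∈ → v∈) , false ∷ []) , ((λ v∈ → v∈) , ⊥⊆) ,
      ((λ v∈ → v∈) , X⁺∩X⁻≡∅ sample) ,
      subst (_≤ t) (sym (cong ∣_∣ (∪-identityʳ X⁺))) (unidentified-small sample unidentified) ,
      m≤n+m 1 _
      where
      -- Decidability recovers a usable witness from the irrelevant `s`. It enters only the proofs,
      -- not the compressed output.
      sample = recompute (isSample? H X⁺ X⁻) s

      X⁺∩X⁻≡∅ : IsSample H X⁺ X⁻ → Empty (X⁺ ∩ X⁻)
      X⁺∩X⁻≡∅ (e , _ , X⁺⊆e , X⁻∩e≡∅) (v , v∈) with v∈X⁺ , v∈X⁻ ← x∈p∩q⁻ X⁺ X⁻ v∈ =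
        X⁻∩e≡∅ (v , x∈p∩q⁺ (v∈X⁻ , X⁺⊆e v∈X⁺))

    scheme : CompressionScheme H
    scheme = record
      { κ          = proj₁ ∘ compress
      ; ρ          = decompress
      ; κ-sub      = λ X → proj₁ (proj₂ (compress X))
      ; ρκ-realize = λ X → proj₁ (proj₂ (proj₂ (compress X)))
      }

    size≤ : CompressionScheme.size scheme ≤ t + (⌈log₂ (t + 1) ⌉ + 1)
    size≤ = +-mono-≤
      (maxSample-lub H _ λ X → proj₁ (proj₂ (proj₂ (proj₂ (compress X)))))
      (maxSample-lub H _ λ X → proj₂ (proj₂ (proj₂ (proj₂ (compress X)))))

theorem1p5 : (t : ℕ) → 1 ≤ t → (n : ℕ) (G : Graph n) → DegeneracyAtMost G t →
    Σ[ C ∈ CompressionScheme (closedNeighbourhoods G) ]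
    CompressionScheme.size C ≤ t + ⌈log₂ (t + 1) ⌉ + 1
theorem1p5 t 1≤t n G (_ , sto , degenerate) =
  scheme G sto 1≤t degenerate ,
  ≤-trans (size≤ G sto 1≤t degenerate) (≤-reflexive (sym (+-assoc t _ 1)))
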